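{- Let $G=(V,E)$ be a finite connected graph, and let $V=A\sqcup B$ be a partition such that the induced subgraphs $G[A]$ and $G[B]$ are connected and every vertex of $B$ is adjacent to some vertex of $A$. Set $E_L=E(A)\cup E(A,B)$ and $E_R=E(B)$. Let $B_G\subseteq\mathbb{F}_2^{E}$ be the cut space of $G$ and let $s$ be the state complexity of the code $B_G$ at the bipartition $E=E_L\sqcup E_R$. Then $s=|B|-1$, and consequently the conditional ground-state matrix $W$ of $G$ across $(E_L,E_R)$ has min-plus factorization rank exactly $2^{|B|-1}$ and tropical rank exactly $2^{|B|-1}$.
   Context: Connected graphs are nonempty. $E(A)$ and $E(B)$ are the sets of edges with both endpoints in $A$, respectively in $B$; $E(A,B)$ is the set of edges with one endpoint in each. For $S\subseteq V$, $\delta(S)\in\mathbb{F}_2^E$ is (the indicator vector of) the set of edges with exactly one endpoint in $S$. The cut space is $B_G=\{\delta(S):S\subseteq V\}$, a linear subspace of $\mathbb{F}_2^E$. State complexity: for a linear code $C\subseteq\mathbb{F}_2^{E}$ and a bipartition $E=E_L\sqcup E_R$ of coordinates, $s=\dim C-\dim C_L-\dim C_R$, where $C_L=\{c\in C:c|_{E_R}=0\}$ and $C_R=\{c\in C:c|_{E_L}=0\}$. The conditional ground-state matrix $W$ has rows indexed by $\mathbb{F}_2^{E_L}$, columns indexed by $\mathbb{F}_2^{E_R}$, and entries $W(\omega_L,\omega_R)=\min_{S\subseteq V}|(\omega_L,\omega_R)\oplus\delta(S)|$, where $|\cdot|$ is Hamming weight (the frustration index of the signing of $G$ whose set of negative edges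 is $\omega=(\omega_L,\omega_R)$). Min-plus factorization rank: the least $r$ such that there are functions $u_1,\dots,u_r$ on the row index set and $v_1,\dots,v_r$ on the column index set, with values in $\mathbb{R}\cup\{+\infty\}$, with $W(x,y)=\min_{1\le t\le r}(u_t(x)+v_t(y))$ for all $x,y$. Tropical rank: the largest order $r$ of a square submatrix $N$ of $W$ for which the minimum $\min_{\sigma\in S_r}\sum_i N(i,\sigma(i))$ is attained by a unique permutation. -}

module Defs where

open import Algebra.Bundles using (module CommutativeMonoid)
open import Algebra.Properties.CommutativeMonoid.Sum using (sum)
import Algebra.Properties.CommutativeSemigroup as CommutativeSemigroupProperties
open import Data.Bool.Base using (Bool; false; _∧_; _∨_; _xor_)
open import Data.Fin.Base using (Fin)
open import Data.Fin.Permutation using (Permutation′; _⟨$⟩ʳ_; _≈_)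
open import Data.Fin.Subset using (Subset; inside; outside; _∈_; _⊆_; ⊥)
  renaming (∣_∣ to hammingWeight)
open import Data.Integer.Base as ℤ using (ℤ)
import Data.Integer.Tactic.RingSolver as ℤ-Solver
open import Data.Nat.Base as ℕ using (ℕ; zero; suc)
import Data.Nat.Properties as ℕ
open import Data.Product.Base using (Σ-syntax; ∃; ∃-syntax; _×_; _,_)
open import Data.Rational.Unnormalised.Base
  using (ℚᵘ; mkℚᵘ; 0ℚᵘ; _≃_; *≡*; _≤_; _+_; _-_; -_; _⊓_; ∣_∣)
open import Data.Rational.Unnormalised.Properties
open import Data.Sum.Base using (_⊎_; inj₁; inj₂)
open import Data.Vec.Base using (Vec; []; _∷_; lookup; map; replicate; tabulate; zipWith)
import Data.Vec.Functional as Vector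
open import Function.Bundles using (_⇔_; _↣_; module Injection)
open import Level using (0ℓ)
open import Relation.Binary.Construct.Closure.ReflexiveTransitive using (Star)
import Relation.Binary.Construct.Add.Supremum.Equality as Supremum
open import Relation.Binary.PropositionalEquality.Core as ≡ using (_≡_; cong)
open import Relation.Nullary.Construct.Add.Supremum using (_⁺; ⊤⁺; [_])
open import Relation.Unary using (Pred)

private
  variable
    n m k : ℕ
    X Y : Set

-- Edges are undirected: nothing below depends on which end of an edge is
-- called end₁.  Loops and parallel edges are allowed, so simple graphs are
-- a special case.

record Graph (V E : Set) : Set where
  field
    end₁ end₂ : E → V

open Graph public

FiniteGraph : ℕ → ℕ → Set
FiniteGraph n m = Graph (Fin n) (Fin m)

Adjacent : {V E : Set} → Graph V E → V → V → Set
Adjacent G u v = ∃[ e ] ((end₁ G e ≡ u × end₂ G e ≡ v) ⊎ (end₁ G e ≡ v × end₂ G e ≡ u))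

Connected : {V E : Set} → Graph V E → Set
Connected {V} G = V × (∀ u v → Star (Adjacent G) u v)

Induced : (G : FiniteGraph n m) (X : Subset n) →
          Graph (∃ (_∈ X)) (∃[ e ] (end₁ G e ∈ X × end₂ G e ∈ X))
Induced G X = record
  { end₁ = λ (e , p , q) → end₁ G e , p
  ; end₂ = λ (e , p , q) → end₂ G e , q
  }

E⟨_⟩ : FiniteGraph n m → Subset n → Subset m
E⟨ G ⟩ X = tabulate λ e → lookup X (end₁ G e) ∧ lookup X (end₂ G e)

E⟨_⟩₂ : FiniteGraph n m → Subset n → Subset n → Subset m
E⟨ G ⟩₂ X Y = tabulate λ e →
  (lookup X (end₁ G e) ∧ lookup Y (end₂ G e)) ∨ (lookup Y (end₁ G e) ∧ lookup X (end₂ G e))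

-- 𝔽₂ is Bool with _xor_ and _∧_, so 𝔽₂^m is definitionally Subset m, the
-- zero vector is ⊥ and the Hamming weight is cardinality.

infixl 6 _⊕_

_⊕_ : Subset m → Subset m → Subset m
_⊕_ = zipWith _xor_

combination : Vec Bool k → Vec (Subset m) k → Subset m
combination []       []       = ⊥
combination (c ∷ cs) (b ∷ bs) = map (c ∧_) b ⊕ combination cs bs

Independent : Vec (Subset m) k → Set
Independent bs = ∀ cs → combination cs bs ≡ ⊥ → cs ≡ replicate _ false

HasDimension : Pred (Subset m) 0ℓ → ℕ → Set
HasDimension C d = Σ[ bs ∈ Vec (Subset _) d ]
  Independent bs × (∀ c → C c ⇔ (∃[ cs ] combination cs bs ≡ c))

VanishingOn : Pred (Subset m) 0ℓ → Subset m → Pred (Subset m) 0ℓ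
VanishingOn C F c = C c × (∀ e → e ∈ F → lookup c e ≡ false)

-- s = dim C − dim C_L − dim C_R, written additively because subtraction on
-- ℕ truncates.

StateComplexity : Pred (Subset m) 0ℓ → (L R : Subset m) → ℕ → Set
StateComplexity C L R s = ∃[ d ] ∃[ dL ] ∃[ dR ]
  HasDimension C d ×
  HasDimension (VanishingOn C R) dL ×
  HasDimension (VanishingOn C L) dR ×
  s ℕ.+ dL ℕ.+ dR ≡ d

δ : FiniteGraph n m → Subset n → Subset m
δ G S = tabulate λ e → lookup S (end₁ G e) xor lookup S (end₂ G e)

CutSpace : FiniteGraph n m → Pred (Subset m) 0ℓ
CutSpace G c = ∃[ S ] δ G S ≡ c

minSubset : ∀ n → (Subset n → ℕ) → ℕ
minSubset zero    f = f []
minSubset (suc n) f =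
  minSubset n (λ S → f (inside ∷ S)) ℕ.⊓ minSubset n (λ S → f (outside ∷ S))

-- For a set F of coordinates, 𝔽₂^F is represented by the vectors of 𝔽₂^m
-- that vanish off F; for E = L ⊔ R the pair (ω_L , ω_R) is then ω_L ⊕ ω_R.
-- Irrelevance of the proof makes _≡_ on 𝔽₂^ F equality of vectors.

record 𝔽₂^_ (F : Subset m) : Set where
  constructor supported
  field
    vector       : Subset m
    .vanishesOff : vector ⊆ F

open 𝔽₂^_ public

groundState : FiniteGraph n m → (L R : Subset m) → 𝔽₂^ L → 𝔽₂^ R → ℕ
groundState {n} G L R ωL ωR = minSubset n λ S → hammingWeight ((vector ωL ⊕ vector ωR) ⊕ δ G S)

-- Real numbers, as regular Cauchy sequences of rationals (Bishop).

1/suc_ : ℕ → ℚᵘ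
1/suc i = mkℚᵘ (ℤ.+ 1) i

record ℝ : Set where
  field
    approx  : ℕ → ℚᵘ
    regular : ∀ i j → ∣ approx i - approx j ∣ ≤ 1/suc i + 1/suc j

open ℝ public

infix 4 _≈ℝ_

_≈ℝ_ : ℝ → ℝ → Set
x ≈ℝ y = ∀ i → ∣ approx x i - approx y i ∣ ≤ mkℚᵘ (ℤ.+ 2) i

p≤∣p∣ : ∀ p → p ≤ ∣ p ∣
p≤∣p∣ p with ≤-total 0ℚᵘ p
... | inj₁ 0≤p = ≤-reflexive (≃-sym (0≤p⇒∣p∣≃p 0≤p))
... | inj₂ p≤0 = ≤-trans p≤0 (0≤∣p∣ p)

-[p-q]≃q-p : ∀ p q → - (p - q) ≃ q - p
-[p-q]≃q-p p q = begin-equality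
  - (p - q)    ≡⟨ neg-distrib-+ p (- q) ⟩
  - p + - - q  ≡⟨ cong (- p +_) (neg-involutive-≡ q) ⟩
  - p + q      ≃⟨ +-comm (- p) q ⟩
  q - p        ∎
  where open ≤-Reasoning

∣p-q∣≃∣q-p∣ : ∀ p q → ∣ p - q ∣ ≃ ∣ q - p ∣
∣p-q∣≃∣q-p∣ p q = ≃-trans (≃-sym (∣-p∣≃∣p∣ (p - q))) (∣-∣-cong (-[p-q]≃q-p p q))

∣p-q∣≤e⇒p≤e+q : ∀ p q {e} → ∣ p - q ∣ ≤ e → p ≤ e + q
∣p-q∣≤e⇒p≤e+q p q {e} h = begin
  p              ≃⟨ +-identityʳ p ⟨
  p + 0ℚᵘ        ≃⟨ +-congʳ p (+-inverseˡ q) ⟨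
  p + (- q + q)  ≃⟨ +-assoc p (- q) q ⟨
  (p - q) + q    ≤⟨ +-monoˡ-≤ q (≤-trans (p≤∣p∣ (p - q)) h) ⟩
  e + q          ∎
  where open ≤-Reasoning

p≤e+q⇒p-q≤e : ∀ {p q e} → p ≤ e + q → p - q ≤ e
p≤e+q⇒p-q≤e {p} {q} {e} h = begin
  p - q        ≤⟨ +-monoˡ-≤ (- q) h ⟩
  (e + q) - q  ≃⟨ +-assoc e q (- q) ⟩
  e + (q - q)  ≃⟨ +-congʳ e (+-inverseʳ q) ⟩
  e + 0ℚᵘ      ≃⟨ +-identityʳ e ⟩
  e            ∎
  where open ≤-Reasoning

p≤e+q∧q≤e+p⇒∣p-q∣≤e : ∀ {p q e} → p ≤ e + q → q ≤ e + p → ∣ p - q ∣ ≤ e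
p≤e+q∧q≤e+p⇒∣p-q∣≤e {p} {q} h₁ h₂ with ∣p∣≡p∨∣p∣≡-p (p - q)
... | inj₁ eq = ≤-respˡ-≃ (≃-reflexive (≡.sym eq)) (p≤e+q⇒p-q≤e h₁)
... | inj₂ eq = ≤-respˡ-≃
  (≃-sym (≃-trans (≃-reflexive eq) (-[p-q]≃q-p p q))) (p≤e+q⇒p-q≤e h₂)

∣⊓-⊓∣≤ : ∀ p p′ q q′ {e} → ∣ p - p′ ∣ ≤ e → ∣ q - q′ ∣ ≤ e → ∣ p ⊓ q - p′ ⊓ q′ ∣ ≤ e
∣⊓-⊓∣≤ p p′ q q′ {e} h₁ h₂ = p≤e+q∧q≤e+p⇒∣p-q∣≤e
  (bound p p′ q q′ h₁ h₂)
  (bound p′ p q′ q (≤-respˡ-≃ (∣p-q∣≃∣q-p∣ p p′) h₁) (≤-respˡ-≃ (∣p-q∣≃∣q-p∣ q q′) h₂))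
  where
  open ≤-Reasoning
  bound : ∀ p p′ q q′ → ∣ p - p′ ∣ ≤ e → ∣ q - q′ ∣ ≤ e → p ⊓ q ≤ e + p′ ⊓ q′
  bound p p′ q q′ h₁ h₂ = begin
    p ⊓ q                ≤⟨ ⊓-mono-≤ (∣p-q∣≤e⇒p≤e+q p p′ h₁) (∣p-q∣≤e⇒p≤e+q q q′ h₂) ⟩
    (e + p′) ⊓ (e + q′)  ≃⟨ mono-≤-distrib-⊓ (+-monoʳ-≤ e) p′ q′ ⟨
    e + p′ ⊓ q′          ∎

+-interchange : ∀ p q r s → (p + q) + (r + s) ≃ (p + r) + (q + s)
+-interchange = CommutativeSemigroupProperties.interchange
  (CommutativeMonoid.commutativeSemigroup +-0-commutativeMonoid)

∣+-+∣≤ : ∀ p p′ q q′ {e f} → ∣ p - p′ ∣ ≤ e → ∣ q - q′ ∣ ≤ f → ∣ (p + q) - (p′ + q′) ∣ ≤ e + f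
∣+-+∣≤ p p′ q q′ {e} {f} h₁ h₂ = begin
  ∣ (p + q) - (p′ + q′) ∣      ≡⟨ cong (λ z → ∣ (p + q) + z ∣) (neg-distrib-+ p′ q′) ⟩
  ∣ (p + q) + (- p′ + - q′) ∣  ≃⟨ ∣-∣-cong (+-interchange p q (- p′) (- q′)) ⟩
  ∣ (p - p′) + (q - q′) ∣      ≤⟨ ∣p+q∣≤∣p∣+∣q∣ (p - p′) (q - q′) ⟩
  ∣ p - p′ ∣ + ∣ q - q′ ∣      ≤⟨ +-mono-≤ h₁ h₂ ⟩
  e + f                        ∎
  where open ≤-Reasoning

-- 1/suc double i is half of 1/suc i.

double : ℕ → ℕ
double i = i ℕ.+ suc i

half+half : ∀ i → 1/suc (double i) + 1/suc (double i) ≃ 1/suc i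
half+half i = *≡* (lemma (ℤ.+ suc i))
  where
  lemma : ∀ (x : ℤ) → (ℤ.+ 1 ℤ.* (x ℤ.+ x) ℤ.+ ℤ.+ 1 ℤ.* (x ℤ.+ x)) ℤ.* x ≡ ℤ.+ 1 ℤ.* ((x ℤ.+ x) ℤ.* (x ℤ.+ x))
  lemma = ℤ-Solver.solve-∀

infixl 6 _+ℝ_
infixl 7 _⊓ℝ_

_+ℝ_ : ℝ → ℝ → ℝ
x +ℝ y = record
  { approx  = λ i → approx x (double i) + approx y (double i)
  ; regular = λ i j → ≤-respʳ-≃
      (≃-trans (+-interchange (1/suc double i) (1/suc double j) (1/suc double i) (1/suc double j))
               (+-cong (half+half i) (half+half j)))
      (∣+-+∣≤ (approx x (double i)) (approx x (double j)) (approx y (double i)) (approx y (double j))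
              (regular x (double i) (double j)) (regular y (double i) (double j)))
  }

_⊓ℝ_ : ℝ → ℝ → ℝ
x ⊓ℝ y = record
  { approx  = λ i → approx x i ⊓ approx y i
  ; regular = λ i j → ∣⊓-⊓∣≤ (approx x i) (approx x j) (approx y i) (approx y j)
                             (regular x i j) (regular y i j)
  }

fromℚᵘ : ℚᵘ → ℝ
fromℚᵘ q = record
  { approx  = λ _ → q
  ; regular = λ i j → ≤-trans (≤-reflexive (∣-∣-cong (+-inverseʳ q)))
                              (≤-trans (nonNegative⁻¹ (1/suc i)) (p≤p+q (1/suc i) (1/suc j)))
  }

fromℕ : ℕ → ℝ
fromℕ a = fromℚᵘ (mkℚᵘ (ℤ.+ a) 0)

-- +∞ is ⊤⁺.

open Supremum _≈ℝ_ public using (_≈⁺_)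

infixl 6 _+⁺_
infixl 7 _⊓⁺_

_+⁺_ : ℝ ⁺ → ℝ ⁺ → ℝ ⁺
[ x ] +⁺ [ y ] = [ x +ℝ y ]
[ _ ] +⁺ ⊤⁺    = ⊤⁺
⊤⁺    +⁺ _     = ⊤⁺

_⊓⁺_ : ℝ ⁺ → ℝ ⁺ → ℝ ⁺
[ x ] ⊓⁺ [ y ] = [ x ⊓ℝ y ]
[ x ] ⊓⁺ ⊤⁺    = [ x ]
⊤⁺    ⊓⁺ y     = y

minimum : (Fin k → ℝ ⁺) → ℝ ⁺
minimum = Vector.foldr _⊓⁺_ ⊤⁺

MinPlusFactorization : (X → Y → ℕ) → ℕ → Set
MinPlusFactorization {X} {Y} W r =
  Σ[ u ∈ (Fin r → X → ℝ ⁺) ] Σ[ v ∈ (Fin r → Y → ℝ ⁺) ]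
    (∀ x y → [ fromℕ (W x y) ] ≈⁺ minimum (λ t → u t x +⁺ v t y))

HasMinPlusRank : (X → Y → ℕ) → ℕ → Set
HasMinPlusRank W r =
  MinPlusFactorization W r × (∀ r′ → MinPlusFactorization W r′ → r ℕ.≤ r′)

permutationSum : (Fin k → Fin k → ℕ) → Permutation′ k → ℕ
permutationSum N σ = sum ℕ.+-0-commutativeMonoid (λ i → N i (σ ⟨$⟩ʳ i))

IsMinimizer : (Fin k → Fin k → ℕ) → Permutation′ k → Set
IsMinimizer N σ = ∀ τ → permutationSum N σ ℕ.≤ permutationSum N τ

UniquelyMinimized : (Fin k → Fin k → ℕ) → Set
UniquelyMinimized N = ∃[ σ ] IsMinimizer N σ × (∀ τ → IsMinimizer N τ → τ ≈ σ)

HasUniquelyMinimizedSubmatrix : (X → Y → ℕ) → ℕ → Set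
HasUniquelyMinimizedSubmatrix {X} {Y} W r =
  Σ[ f ∈ Fin r ↣ X ] Σ[ g ∈ Fin r ↣ Y ]
    UniquelyMinimized (λ i j → W (Injection.to f i) (Injection.to g j))

HasTropicalRank : (X → Y → ℕ) → ℕ → Set
HasTropicalRank W r =
  HasUniquelyMinimizedSubmatrix W r ×
  (∀ r′ → HasUniquelyMinimizedSubmatrix W r′ → r′ ℕ.≤ r)

{-# OPTIONS --safe #-}
-- Since S and V ∖ S have the same boundary, a cut is determined by its side that
-- avoids a fixed root of B, and its restriction to E(B) by a subset T of
-- B ∖ {root}.  Minimizing first over the part of S in A and then over T
-- writes W as a minimum of 2^(|B|-1) terms u_T(ω_L) + v_T(ω_R).  Conversely the
-- rows δ(T)|_L and columns δ(T)|_R give a square submatrix that vanishes exactly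
-- on its diagonal: a zero entry at (T, T′) is realised by a cut agreeing with δ(T)
-- on L and with δ(T′) on R, and as δ(S)|_L determines S up to complement and δ(S)|_R
-- determines S ∩ B up to complement in B, T = T′.  No term of a min-plus
-- factorization can attain two of these zeros, for exchanging their columns
-- would produce a nonpositive off-diagonal sum.

module Submission where

open import Defs
open import Algebra.Bundles using (module CommutativeMonoid; module CommutativeRing)
open import Algebra.Properties.CommutativeMonoid.Sum using (sum; ∑-distrib-+; sum-permute; sum-cong-≗)
import Algebra.Properties.CommutativeSemigroup as CommutativeSemigroupProperties
open import Data.Bool.Base using (Bool; true; false; not; _∧_; _∨_; _xor_)
import Data.Bool.Properties as Bool
open import Data.Empty using (⊥-elim; ⊥-elim-irr)
import Data.Empty as Empty
open import Data.Fin.Base using (Fin; zero; suc; combine; finToFun; funToFin)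
open import Data.Fin.Permutation using (Permutation′; _⟨$⟩ʳ_; _∘ₚ_; transpose; id)
import Data.Fin.Properties as Fin
open import Data.Fin.Subset using (Subset; inside; outside; _∈_; _∪_; _∩_; _-_; ∁; ⊤; ⊥; ∣_∣)
import Data.Fin.Subset.Properties as Subset
import Data.Integer.Base as ℤ
import Data.Integer.Properties as ℤ
open import Data.Nat.Base using (ℕ; zero; suc; _+_; _∸_; _^_; _≤_; z≤n)
import Data.Nat.Properties as ℕ
open import Data.Product.Base using (_×_; _,_; proj₁; proj₂; ∃-syntax)
open import Data.Rational.Unnormalised.Base as ℚᵘ using (ℚᵘ; mkℚᵘ)
import Data.Rational.Unnormalised.Properties as ℚᵘ
open import Data.Sum.Base using (_⊎_; inj₁; inj₂; [_,_]′)
import Data.Unit.Base as Unit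
open import Data.Vec.Base using (Vec; []; _∷_; lookup; map; replicate; tabulate)
import Data.Vec.Properties as Vec
open import Function.Base using (_∘_)
open import Function.Bundles using (module Injection; module Inverse; mk↣; mk⇔)
import Relation.Binary.Construct.Add.Supremum.Equality _≈ℝ_ as ≈⁺
open import Relation.Binary.Construct.Closure.ReflexiveTransitive using (Star; fold)
open import Relation.Binary.PropositionalEquality
open import Relation.Nullary using (yes; no; contradiction)
open import Relation.Nullary.Construct.Add.Supremum using (_⁺; ⊤⁺; [_])
open import Relation.Nullary.Decidable using (dec-true; from-no)
open import Relation.Unary using (Pred)

private
  variable
    n m k r : ℕ
    X Y : Set

-- Ranks of matrices over ℕ

∑ : (Fin n → ℕ) → ℕ
∑ = sum ℕ.+-0-commutativeMonoid

∑-mono-≤ : {f g : Fin n → ℕ} → (∀ i → f i ≤ g i) → ∑ f ≤ ∑ g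
∑-mono-≤ {zero}  f≤g = z≤n
∑-mono-≤ {suc n} f≤g = ℕ.+-mono-≤ (f≤g zero) (∑-mono-≤ (f≤g ∘ suc))

f≤∑f : (f : Fin n → ℕ) → ∀ i → f i ≤ ∑ f
f≤∑f f zero    = ℕ.m≤m+n _ _
f≤∑f f (suc i) = ℕ.≤-trans (f≤∑f (f ∘ suc) i) (ℕ.m≤n+m _ _)

∑-zero : {f : Fin n → ℕ} → (∀ i → f i ≡ 0) → ∑ f ≡ 0
∑-zero {zero}  f≡0 = refl
∑-zero {suc n} f≡0 = cong₂ _+_ (f≡0 zero) (∑-zero (f≡0 ∘ suc))

transpose-first : (i j : Fin n) → transpose i j ⟨$⟩ʳ i ≡ j
transpose-first i j rewrite dec-true (i Fin.≟ i) refl = refl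

transpose-invariant : {i j : Fin n} (t : Fin n → X) → t i ≡ t j →
                      ∀ l → t (transpose i j ⟨$⟩ʳ l) ≡ t l
transpose-invariant {i = i} {j} t ti≡tj l with l Fin.≟ i
... | yes refl = sym ti≡tj
... | no  _ with l Fin.≟ j
...   | yes refl = ti≡tj
...   | no  _    = refl

-- The minimum is replaced by its two defining properties. One such family bounds both ranks from
-- above: read in the reals it is a min-plus factorization, and its number of terms limits the order
-- of every uniquely minimized submatrix.
record IsNatFactorization (W : X → Y → ℕ) (u : Fin k → X → ℕ) (v : Fin k → Y → ℕ) : Set where
  field
    bound    : ∀ x y t → W x y ≤ u t x + v t y
    attained : ∀ x y → ∃[ t ] u t x + v t y ≤ W x y

-- The counterpart for lower bounds: such a submatrix of order `r` forces `r` terms in every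
-- min-plus factorization and is itself uniquely minimized.
record ZeroExactlyOnDiagonal (W : X → Y → ℕ) (f : Fin r → X) (g : Fin r → Y) : Set where
  field
    zero-diagonal : ∀ i → W (f i) (g i) ≡ 0
    diagonal-only : ∀ i j → W (f i) (g j) ≡ 0 → i ≡ j

module _ {W : X → Y → ℕ} {u : Fin k → X → ℕ} {v : Fin k → Y → ℕ}
         (fac : IsNatFactorization W u v) where
  open IsNatFactorization fac

  -- If two rows i and j attain their entry under σ in the same term t, then
  -- composing σ with the transposition (i j) does not increase the sum.
  uniquelyMinimized⇒≤ : HasUniquelyMinimizedSubmatrix W r → r ≤ k
  uniquelyMinimized⇒≤ {r} (f , g , σ , σ-min , σ-unique) = Fin.injective⇒≤ term-injective
    where
    x : Fin r → X
    x = Injection.to f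
    y : Fin r → Y
    y = Injection.to g
    N : Fin r → Fin r → ℕ
    N i j = W (x i) (y j)
    term : Fin r → Fin k
    term i = proj₁ (attained (x i) (y (σ ⟨$⟩ʳ i)))

    term-injective : ∀ {i j} → term i ≡ term j → i ≡ j
    term-injective {i} {j} ti≡tj =
      trans (sym (Inverse.strictlyInverseʳ σ i))
        (trans (cong (Inverse.from σ) (sym σj≡σi)) (Inverse.strictlyInverseʳ σ j))
      where
      π τ : Permutation′ r
      π = transpose i j
      τ = π ∘ₚ σ
      p q : Fin r → ℕ
      p l = u (term l) (x l)
      q l = v (term l) (y (σ ⟨$⟩ʳ l))
      -- `π` exchanges two rows with the same term, so the column summands along `τ` are those along
      -- `σ`, permuted by `π`; their sum is unchanged.
      qπ : ∀ l → v (term l) (y (τ ⟨$⟩ʳ l)) ≡ q (π ⟨$⟩ʳ l)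
      qπ l = cong (λ t → v t (y (τ ⟨$⟩ʳ l))) (sym (transpose-invariant term ti≡tj l))
      τ≤σ : permutationSum N τ ≤ permutationSum N σ
      τ≤σ = begin
        permutationSum N τ                          ≤⟨ ∑-mono-≤ (λ l → bound (x l) (y (τ ⟨$⟩ʳ l)) (term l)) ⟩
        ∑ (λ l → p l + v (term l) (y (τ ⟨$⟩ʳ l)))   ≡⟨ sum-cong-≗ ℕ.+-0-commutativeMonoid (λ l → cong (p l +_) (qπ l)) ⟩
        ∑ (λ l → p l + q (π ⟨$⟩ʳ l))                ≡⟨ ∑-distrib-+ ℕ.+-0-commutativeMonoid p (q ∘ (π ⟨$⟩ʳ_)) ⟩
        ∑ p + ∑ (q ∘ (π ⟨$⟩ʳ_))                     ≡⟨ cong (∑ p +_) (sum-permute ℕ.+-0-commutativeMonoid q π) ⟨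
        ∑ p + ∑ q                                   ≡⟨ ∑-distrib-+ ℕ.+-0-commutativeMonoid p q ⟨
        ∑ (λ l → p l + q l)                         ≤⟨ ∑-mono-≤ (λ l → proj₂ (attained (x l) (y (σ ⟨$⟩ʳ l)))) ⟩
        permutationSum N σ                          ∎
        where open ℕ.≤-Reasoning
      -- Now `τ` is a minimizer as well, so uniqueness makes it agree with `σ` at `i`, where its
      -- value is that of `σ` at `j`.
      σj≡σi : σ ⟨$⟩ʳ j ≡ σ ⟨$⟩ʳ i
      σj≡σi = trans (cong (σ ⟨$⟩ʳ_) (sym (transpose-first i j)))
        (σ-unique τ (λ ρ → ℕ.≤-trans τ≤σ (σ-min ρ)) i)

-- Extended reals compared with rationals at a fixed index of approximation

AtMost AtLeast : ℕ → ℚᵘ → ℝ ⁺ → Set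
AtMost  i q [ x ] = approx x i ℚᵘ.≤ q
AtMost  i q ⊤⁺    = Empty.⊥
AtLeast i q [ x ] = q ℚᵘ.≤ approx x i
AtLeast i q ⊤⁺    = Unit.⊤

module _ {i : ℕ} {q : ℚᵘ} where

  ⊓⁺-atMostˡ : ∀ x y → AtMost i q x → AtMost i q (x ⊓⁺ y)
  ⊓⁺-atMostˡ [ x ] [ y ] h = ℚᵘ.≤-trans (ℚᵘ.p⊓q≤p (approx x i) (approx y i)) h
  ⊓⁺-atMostˡ [ x ] ⊤⁺    h = h

  ⊓⁺-atMostʳ : ∀ x y → AtMost i q y → AtMost i q (x ⊓⁺ y)
  ⊓⁺-atMostʳ [ x ] [ y ] h = ℚᵘ.≤-trans (ℚᵘ.p⊓q≤q (approx x i) (approx y i)) h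
  ⊓⁺-atMostʳ ⊤⁺    y     h = h

  -- This is the reason for testing at a fixed index: the smaller of two rational approximations can
  -- be selected, whereas the order of two Cauchy reals is not decidable.
  ⊓⁺-atMost⁻ : ∀ x y → AtMost i q (x ⊓⁺ y) → AtMost i q x ⊎ AtMost i q y
  ⊓⁺-atMost⁻ [ x ] [ y ] h with ℚᵘ.⊓-sel (approx x i) (approx y i)
  ... | inj₁ eq = inj₁ (ℚᵘ.≤-respˡ-≃ eq h)
  ... | inj₂ eq = inj₂ (ℚᵘ.≤-respˡ-≃ eq h)
  ⊓⁺-atMost⁻ [ x ] ⊤⁺    h = inj₁ h
  ⊓⁺-atMost⁻ ⊤⁺    y     h = inj₂ h

  ⊓⁺-atLeast : ∀ x y → AtLeast i q x → AtLeast i q y → AtLeast i q (x ⊓⁺ y)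
  ⊓⁺-atLeast [ x ] [ y ] h₁ h₂ = ℚᵘ.⊓-glb h₁ h₂
  ⊓⁺-atLeast [ x ] ⊤⁺    h₁ h₂ = h₁
  ⊓⁺-atLeast ⊤⁺    y     h₁ h₂ = h₂

  ⊓⁺-atLeastˡ⁻ : ∀ x y → AtLeast i q (x ⊓⁺ y) → AtLeast i q x
  ⊓⁺-atLeastˡ⁻ [ x ] [ y ] h = ℚᵘ.≤-trans h (ℚᵘ.p⊓q≤p (approx x i) (approx y i))
  ⊓⁺-atLeastˡ⁻ [ x ] ⊤⁺    h = h
  ⊓⁺-atLeastˡ⁻ ⊤⁺    y     h = _

  ⊓⁺-atLeastʳ⁻ : ∀ x y → AtLeast i q (x ⊓⁺ y) → AtLeast i q y
  ⊓⁺-atLeastʳ⁻ [ x ] [ y ] h = ℚᵘ.≤-trans h (ℚᵘ.p⊓q≤q (approx x i) (approx y i))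
  ⊓⁺-atLeastʳ⁻ [ x ] ⊤⁺    h = _
  ⊓⁺-atLeastʳ⁻ ⊤⁺    y     h = h

  minimum-atMost : (f : Fin k → ℝ ⁺) → ∀ t → AtMost i q (f t) → AtMost i q (minimum f)
  minimum-atMost f zero    h = ⊓⁺-atMostˡ (f zero) _ h
  minimum-atMost f (suc t) h = ⊓⁺-atMostʳ (f zero) _ (minimum-atMost (f ∘ suc) t h)

  minimum-atMost⁻ : (f : Fin k → ℝ ⁺) → AtMost i q (minimum f) → ∃[ t ] AtMost i q (f t)
  minimum-atMost⁻ {suc k} f h with ⊓⁺-atMost⁻ (f zero) _ h
  ... | inj₁ h₀ = zero , h₀
  ... | inj₂ h₁ = let t , ht = minimum-atMost⁻ (f ∘ suc) h₁ in suc t , ht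

  minimum-atLeast : (f : Fin k → ℝ ⁺) → (∀ t → AtLeast i q (f t)) → AtLeast i q (minimum f)
  minimum-atLeast {zero}  f h = _
  minimum-atLeast {suc k} f h = ⊓⁺-atLeast (f zero) _ (h zero) (minimum-atLeast (f ∘ suc) (h ∘ suc))

  minimum-atLeast⁻ : (f : Fin k → ℝ ⁺) → AtLeast i q (minimum f) → ∀ t → AtLeast i q (f t)
  minimum-atLeast⁻ f h zero    = ⊓⁺-atLeastˡ⁻ (f zero) _ h
  minimum-atLeast⁻ f h (suc t) = minimum-atLeast⁻ (f ∘ suc) (⊓⁺-atLeastʳ⁻ (f zero) _ h) t

ℕ⇒ℚᵘ : ℕ → ℚᵘ
ℕ⇒ℚᵘ a = mkℚᵘ (ℤ.+ a) 0

ℕ⇒ℚᵘ-mono-≤ : ∀ {a b} → a ≤ b → ℕ⇒ℚᵘ a ℚᵘ.≤ ℕ⇒ℚᵘ b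
ℕ⇒ℚᵘ-mono-≤ {a} {b} a≤b = ℚᵘ.*≤* (subst₂ ℤ._≤_ (sym (ℤ.*-identityʳ (ℤ.+ a))) (sym (ℤ.*-identityʳ (ℤ.+ b))) (ℤ.+≤+ a≤b))

ℕ⇒ℚᵘ-+ : ∀ a b → ℕ⇒ℚᵘ a ℚᵘ.+ ℕ⇒ℚᵘ b ℚᵘ.≃ ℕ⇒ℚᵘ (a + b)
ℕ⇒ℚᵘ-+ a b = ℚᵘ.*≡* (cong₂ (λ p q → (p ℤ.+ q) ℤ.* ℤ.+ 1) (ℤ.*-identityʳ (ℤ.+ a)) (ℤ.*-identityʳ (ℤ.+ b)))

fromℕ≈⁺ : ∀ w x → (∀ i → AtMost i (ℕ⇒ℚᵘ w) x) → (∀ i → AtLeast i (ℕ⇒ℚᵘ w) x) → [ fromℕ w ] ≈⁺ x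
fromℕ≈⁺ w [ x ] ≤w ≥w = ≈⁺.[ (λ i → p≤e+q∧q≤e+p⇒∣p-q∣≤e
  (ℚᵘ.≤-trans (≥w i) (ℚᵘ.p≤q+p (approx x i) (mkℚᵘ (ℤ.+ 2) i)))
  (ℚᵘ.≤-trans (≤w i) (ℚᵘ.p≤q+p (ℕ⇒ℚᵘ w) (mkℚᵘ (ℤ.+ 2) i)))) ]
fromℕ≈⁺ w ⊤⁺ ≤w ≥w = ⊥-elim (≤w 0)

factorization⇒minPlus : {W : X → Y → ℕ} {u : Fin k → X → ℕ} {v : Fin k → Y → ℕ} →
                        IsNatFactorization W u v → MinPlusFactorization W k
factorization⇒minPlus {W = W} {u} {v} fac =
    (λ t x → [ fromℕ (u t x) ])
  , (λ t y → [ fromℕ (v t y) ])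
  , λ x y → fromℕ≈⁺ (W x y) _
      (λ i → let t , u+v≤W = attained x y in
        minimum-atMost {i} _ t (ℚᵘ.≤-respˡ-≃ (ℚᵘ.≃-sym (ℕ⇒ℚᵘ-+ (u t x) (v t y))) (ℕ⇒ℚᵘ-mono-≤ u+v≤W)))
      (λ i → minimum-atLeast {i} _ λ t →
        ℚᵘ.≤-respʳ-≃ (ℚᵘ.≃-sym (ℕ⇒ℚᵘ-+ (u t x) (v t y))) (ℕ⇒ℚᵘ-mono-≤ (bound x y t)))
  where open IsNatFactorization fac

fromℕ≈⁺⇒atMost : ∀ {w x} i → [ fromℕ w ] ≈⁺ x → AtMost i (mkℚᵘ (ℤ.+ 2) i ℚᵘ.+ ℕ⇒ℚᵘ w) x
fromℕ≈⁺⇒atMost {w} {[ x ]} i ≈⁺.[ h ] = ∣p-q∣≤e⇒p≤e+q (approx x i) (ℕ⇒ℚᵘ w)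
  (ℚᵘ.≤-respˡ-≃ (∣p-q∣≃∣q-p∣ (ℕ⇒ℚᵘ w) (approx x i)) (h i))

fromℕ≈⁺⇒atLeast : ∀ {w x} i → [ fromℕ w ] ≈⁺ x → AtLeast i (ℕ⇒ℚᵘ w ℚᵘ.- mkℚᵘ (ℤ.+ 2) i) x
fromℕ≈⁺⇒atLeast {w} {[ x ]} i ≈⁺.[ h ] = p≤e+q⇒p-q≤e {q = mkℚᵘ (ℤ.+ 2) i}
  (ℚᵘ.≤-respʳ-≃ (ℚᵘ.+-comm (mkℚᵘ (ℤ.+ 2) i) (approx x i)) (∣p-q∣≤e⇒p≤e+q (ℕ⇒ℚᵘ w) (approx x i) (h i)))

atLeast-weaken : ∀ {i p q} x → p ℚᵘ.≤ q → AtLeast i q x → AtLeast i p x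
atLeast-weaken [ x ] p≤q h = ℚᵘ.≤-trans p≤q h
atLeast-weaken ⊤⁺    p≤q h = _

-- Both pairs of sums add up to the same four summands. `AtMost` is empty at +∞, so all four are
-- finite, and every sum at index `i` reads its summands at the common index `double i`.
swap-atMost-atLeast : ∀ {i p p′ q q′} a b c d →
  AtMost i p (a +⁺ b) → AtMost i p′ (c +⁺ d) →
  AtLeast i q (a +⁺ d) → AtLeast i q′ (c +⁺ b) → q ℚᵘ.+ q′ ℚᵘ.≤ p ℚᵘ.+ p′
swap-atMost-atLeast {i} {p} {p′} {q} {q′} [ a ] [ b ] [ c ] [ d ] ab cd ad cb = begin
  q ℚᵘ.+ q′                          ≤⟨ ℚᵘ.+-mono-≤ ad cb ⟩
  (a′ ℚᵘ.+ d′) ℚᵘ.+ (c′ ℚᵘ.+ b′)     ≃⟨ ℚᵘ.+-congʳ (a′ ℚᵘ.+ d′) (ℚᵘ.+-comm c′ b′) ⟩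
  (a′ ℚᵘ.+ d′) ℚᵘ.+ (b′ ℚᵘ.+ c′)     ≃⟨ +-interchange a′ d′ b′ c′ ⟩
  (a′ ℚᵘ.+ b′) ℚᵘ.+ (d′ ℚᵘ.+ c′)     ≃⟨ ℚᵘ.+-congʳ (a′ ℚᵘ.+ b′) (ℚᵘ.+-comm d′ c′) ⟩
  (a′ ℚᵘ.+ b′) ℚᵘ.+ (c′ ℚᵘ.+ d′)     ≤⟨ ℚᵘ.+-mono-≤ ab cd ⟩
  p ℚᵘ.+ p′                          ∎
  where
  open ℚᵘ.≤-Reasoning
  a′ = approx a (double i)
  b′ = approx b (double i)
  c′ = approx c (double i)
  d′ = approx d (double i)

module _ {W : X → Y → ℕ} {f : Fin r → X} {g : Fin r → Y}
         (diag : ZeroExactlyOnDiagonal W f g) where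
  open ZeroExactlyOnDiagonal diag

  -- At index 7 each of the four approximated entries errs by at most 2/8, in total
  -- by less than the gap 2 between 1 + 1 and 0 + 0.
  zeroDiagonal⇒≤ : ∀ k → MinPlusFactorization W k → r ≤ k
  zeroDiagonal⇒≤ k (u , v , W≈uv) = Fin.injective⇒≤ term-injective
    where
    low high : ℚᵘ
    low  = ℕ⇒ℚᵘ 1 ℚᵘ.- mkℚᵘ (ℤ.+ 2) 7
    high = mkℚᵘ (ℤ.+ 2) 7 ℚᵘ.+ ℕ⇒ℚᵘ 0
    attained : ∀ i → ∃[ t ] AtMost 7 high (u t (f i) +⁺ v t (g i))
    attained i = minimum-atMost⁻ {7} _
      (fromℕ≈⁺⇒atMost 7 (subst (λ w → [ fromℕ w ] ≈⁺ minimum (λ t → u t (f i) +⁺ v t (g i))) (zero-diagonal i) (W≈uv (f i) (g i))))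
    term : Fin r → Fin k
    term i = proj₁ (attained i)
    bound : ∀ {i j} t → i ≢ j → AtLeast 7 low (u t (f i) +⁺ v t (g j))
    bound {i} {j} t i≢j = minimum-atLeast⁻ {7} _
      (atLeast-weaken (minimum (λ t → u t (f i) +⁺ v t (g j)))
        (ℚᵘ.+-monoˡ-≤ (ℚᵘ.- mkℚᵘ (ℤ.+ 2) 7) (ℕ⇒ℚᵘ-mono-≤ (ℕ.n≢0⇒n>0 (i≢j ∘ diagonal-only i j))))
        (fromℕ≈⁺⇒atLeast 7 (W≈uv (f i) (g j)))) t
    term-injective : ∀ {i j} → term i ≡ term j → i ≡ j
    term-injective {i} {j} ti≡tj with i Fin.≟ j
    ... | yes i≡j = i≡j
    ... | no  i≢j = contradiction
      (swap-atMost-atLeast {7} (u t (f i)) (v t (g i)) (u t (f j)) (v t (g j))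
        (proj₂ (attained i))
        (subst (λ t → AtMost 7 high (u t (f j) +⁺ v t (g j))) (sym ti≡tj) (proj₂ (attained j)))
        (bound t i≢j) (bound t (i≢j ∘ sym)))
      (from-no (low ℚᵘ.+ low ℚᵘ.≤? high ℚᵘ.+ high))
      where
      t = term i

  -- The identity has sum 0, so for any other minimizer every summand, being a natural number, is 0
  -- and hence lies on the diagonal. Two equal rows or columns would likewise put a zero off the
  -- diagonal.
  zeroDiagonal⇒uniquelyMinimized : HasUniquelyMinimizedSubmatrix W r
  zeroDiagonal⇒uniquelyMinimized =
      mk↣ (λ {i} {j} fi≡fj → diagonal-only i j (trans (cong (λ x → W x (g j)) fi≡fj) (zero-diagonal j)))
    , mk↣ (λ {i} {j} gi≡gj → diagonal-only i j (trans (cong (W (f i)) (sym gi≡gj)) (zero-diagonal i)))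
    , id
    , (λ τ → ℕ.≤-trans (ℕ.≤-reflexive sum-id) z≤n)
    , λ τ τ-min i → sym (diagonal-only i _ (ℕ.n≤0⇒n≡0 (ℕ.≤-trans (f≤∑f _ i)
        (ℕ.≤-trans (τ-min id) (ℕ.≤-reflexive sum-id)))))
    where
    sum-id : permutationSum (λ i j → W (f i) (g j)) id ≡ 0
    sum-id = ∑-zero zero-diagonal

-- Subsets, coordinates and cuts

lookup-ext : {p q : Vec X n} → (∀ i → lookup p i ≡ lookup q i) → p ≡ q
lookup-ext {p = []}    {[]}    h = refl
lookup-ext {p = _ ∷ _} {_ ∷ _} h = cong₂ _∷_ (h zero) (lookup-ext (h ∘ suc))

∣∣-cong : ∀ (p q : Subset n) → (∀ i → lookup p i ≡ lookup q i) → ∣ p ∣ ≡ ∣ q ∣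
∣∣-cong p q h = cong ∣_∣ (lookup-ext {p = p} {q} h)

lookup-⊕ : ∀ (p q : Subset n) i → lookup (p ⊕ q) i ≡ lookup p i xor lookup q i
lookup-⊕ p q i = Vec.lookup-zipWith _xor_ i p q

lookup-∩ : ∀ (p q : Subset n) i → lookup (p ∩ q) i ≡ lookup p i ∧ lookup q i
lookup-∩ p q i = Vec.lookup-zipWith _∧_ i p q

lookup-∪ : ∀ (p q : Subset n) i → lookup (p ∪ q) i ≡ lookup p i ∨ lookup q i
lookup-∪ p q i = Vec.lookup-zipWith _∨_ i p q

lookup-⊥ : ∀ (i : Fin n) → lookup ⊥ i ≡ false
lookup-⊥ i = Vec.lookup-replicate i false

xor-interchange : ∀ a b c d → (a xor b) xor (c xor d) ≡ (a xor c) xor (b xor d)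
xor-interchange = CommutativeSemigroupProperties.interchange
  (CommutativeMonoid.commutativeSemigroup
    (CommutativeRing.+-commutativeMonoid Bool.xor-∧-commutativeRing))

xor-cancelʳ : ∀ a b c → a xor c ≡ b xor c → a ≡ b
xor-cancelʳ true  true  c eq = refl
xor-cancelʳ true  false c eq = contradiction (sym eq) (Bool.not-¬ refl)
xor-cancelʳ false true  c eq = contradiction eq (Bool.not-¬ refl)
xor-cancelʳ false false c eq = refl

⊥-⊕ : ∀ (p : Subset n) → ⊥ ⊕ p ≡ p
⊥-⊕ []      = refl
⊥-⊕ (x ∷ p) = cong (x ∷_) (⊥-⊕ p)

supported-∩ : ∀ (S F : Subset n) → (∀ v → lookup F v ≡ false → lookup S v ≡ false) → S ∩ F ≡ S
supported-∩ S F off = lookup-ext λ v → trans (lookup-∩ S F v) (absorb _ _ (off v))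
  where
  absorb : ∀ s f → (f ≡ false → s ≡ false) → s ∧ f ≡ s
  absorb s true  h = Bool.∧-identityʳ s
  absorb s false h = trans (Bool.∧-zeroʳ s) (sym (h refl))

∣p∣≡0⇒p≡⊥ : (p : Subset n) → ∣ p ∣ ≡ 0 → p ≡ ⊥
∣p∣≡0⇒p≡⊥ []          eq = refl
∣p∣≡0⇒p≡⊥ (false ∷ p) eq = cong (outside ∷_) (∣p∣≡0⇒p≡⊥ p eq)

∣p∣≡∣p∩L∣+∣p∩R∣ : ∀ (L R p : Subset n) → (∀ i → lookup L i ≡ not (lookup R i)) →
                  ∣ p ∣ ≡ ∣ p ∩ L ∣ + ∣ p ∩ R ∣
∣p∣≡∣p∩L∣+∣p∩R∣ []      []          []          h = refl
∣p∣≡∣p∩L∣+∣p∩R∣ (_ ∷ L) (_     ∷ R) (false ∷ p) h = ∣p∣≡∣p∩L∣+∣p∩R∣ L R p (h ∘ suc)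
∣p∣≡∣p∩L∣+∣p∩R∣ (l ∷ L) (true  ∷ R) (true  ∷ p) h rewrite h zero =
  trans (cong suc (∣p∣≡∣p∩L∣+∣p∩R∣ L R p (h ∘ suc))) (sym (ℕ.+-suc _ _))
∣p∣≡∣p∩L∣+∣p∩R∣ (l ∷ L) (false ∷ R) (true  ∷ p) h rewrite h zero =
  cong suc (∣p∣≡∣p∩L∣+∣p∩R∣ L R p (h ∘ suc))

lookup-minus-self : ∀ (p : Subset n) x → lookup (p - x) x ≡ false
lookup-minus-self (true  ∷ p) zero    = refl
lookup-minus-self (false ∷ p) zero    = refl
lookup-minus-self (_     ∷ p) (suc x) = lookup-minus-self p x

lookup-minus : ∀ (p : Subset n) x y → lookup (p - x) y ≡ false → y ≡ x ⊎ lookup p y ≡ false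
lookup-minus p x y eq with y Fin.≟ x | lookup p y in py
... | yes y≡x | _     = inj₁ y≡x
... | no  _   | false = inj₂ refl
... | no  y≢x | true  = contradiction
  (trans (sym (Vec.[]=⇒lookup (Subset.x∈p∧x≢y⇒x∈p-y (Vec.lookup⇒[]= y p py) y≢x))) eq) λ ()

lookup-minus-⊆ : ∀ (p : Subset n) x y → lookup p y ≡ false → lookup (p - x) y ≡ false
lookup-minus-⊆ p x y eq with lookup (p - x) y in py
... | false = refl
... | true  = trans (sym (Vec.[]=⇒lookup (Subset.p─q⊆p p _ (Vec.lookup⇒[]= y (p - x) py)))) eq

suc∣p-x∣≡∣p∣ : ∀ (p : Subset n) x → lookup p x ≡ true → suc ∣ p - x ∣ ≡ ∣ p ∣
suc∣p-x∣≡∣p∣ (true  ∷ p) zero    eq = cong (suc ∘ ∣_∣) (Subset.p─⊥≡p p)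
suc∣p-x∣≡∣p∣ (true  ∷ p) (suc x) eq = cong suc (suc∣p-x∣≡∣p∣ p x eq)
suc∣p-x∣≡∣p∣ (false ∷ p) (suc x) eq = suc∣p-x∣≡∣p∣ p x eq

-- With `gather`, this identifies the vectors of length `∣ F ∣` over 𝔽₂ with the subsets of `F`.
scatter : (F : Subset n) → Vec Bool ∣ F ∣ → Subset n
scatter []          []      = []
scatter (true  ∷ F) (c ∷ cs) = c ∷ scatter F cs
scatter (false ∷ F) cs       = outside ∷ scatter F cs

gather : (F : Subset n) → Subset n → Vec Bool ∣ F ∣
gather []          []      = []
gather (true  ∷ F) (x ∷ S) = x ∷ gather F S
gather (false ∷ F) (x ∷ S) = gather F S

scatter-gather : (F S : Subset n) → scatter F (gather F S) ≡ S ∩ F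
scatter-gather []          []      = refl
scatter-gather (true  ∷ F) (x ∷ S) = cong₂ _∷_ (sym (Bool.∧-identityʳ x)) (scatter-gather F S)
scatter-gather (false ∷ F) (x ∷ S) = cong₂ _∷_ (sym (Bool.∧-zeroʳ x)) (scatter-gather F S)

gather-scatter : (F : Subset n) → ∀ cs → gather F (scatter F cs) ≡ cs
gather-scatter []          []       = refl
gather-scatter (true  ∷ F) (c ∷ cs) = cong (c ∷_) (gather-scatter F cs)
gather-scatter (false ∷ F) cs       = gather-scatter F cs

gather-⊥ : (F : Subset n) → gather F ⊥ ≡ replicate _ false
gather-⊥ []          = refl
gather-⊥ (true  ∷ F) = cong (false ∷_) (gather-⊥ F)
gather-⊥ (false ∷ F) = gather-⊥ F

scatter-supported : (F : Subset n) → ∀ cs v → lookup F v ≡ false → lookup (scatter F cs) v ≡ false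
scatter-supported (true  ∷ F) (c ∷ cs) (suc v) eq = scatter-supported F cs v eq
scatter-supported (false ∷ F) cs       zero    eq = refl
scatter-supported (false ∷ F) cs       (suc v) eq = scatter-supported F cs v eq

-- The standard basis of the space of subsets of `F`; its image under `δ G` consists of the stars of
-- the vertices of `F`.
singletons : (F : Subset n) → Vec (Subset n) ∣ F ∣
singletons []          = []
singletons (true  ∷ F) = (inside ∷ ⊥) ∷ map (outside ∷_) (singletons F)
singletons (false ∷ F) = map (outside ∷_) (singletons F)

combination-map-outside : ∀ cs (bs : Vec (Subset n) k) →
                          combination cs (map (outside ∷_) bs) ≡ outside ∷ combination cs bs
combination-map-outside []       []       = refl
combination-map-outside (c ∷ cs) (b ∷ bs) rewrite combination-map-outside cs bs =
  cong (λ z → (z xor false) ∷ (map (c ∧_) b ⊕ combination cs bs)) (Bool.∧-zeroʳ c)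

scale-⊥ : ∀ c → map (c ∧_) (⊥ {n}) ≡ ⊥
scale-⊥ {zero}  c = refl
scale-⊥ {suc n} c = cong₂ _∷_ (Bool.∧-zeroʳ c) (scale-⊥ c)

combination-singletons : (F : Subset n) → ∀ cs → combination cs (singletons F) ≡ scatter F cs
combination-singletons []          []       = refl
combination-singletons (true  ∷ F) (c ∷ cs)
  rewrite combination-map-outside cs (singletons F) | combination-singletons F cs =
  cong₂ _∷_ (trans (Bool.xor-identityʳ _) (Bool.∧-identityʳ c))
    (trans (cong (_⊕ scatter F cs) (scale-⊥ c)) (⊥-⊕ (scatter F cs)))
combination-singletons (false ∷ F) cs
  rewrite combination-map-outside cs (singletons F) = cong (outside ∷_) (combination-singletons F cs)

minSubset≤ : ∀ n (f : Subset n → ℕ) S → minSubset n f ≤ f S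
minSubset≤ zero    f []          = ℕ.≤-refl
minSubset≤ (suc n) f (true  ∷ S) = ℕ.≤-trans (ℕ.m⊓n≤m _ _) (minSubset≤ n (f ∘ (inside ∷_)) S)
minSubset≤ (suc n) f (false ∷ S) = ℕ.≤-trans (ℕ.m⊓n≤n _ _) (minSubset≤ n (f ∘ (outside ∷_)) S)

minSubset-attained : ∀ n (f : Subset n → ℕ) → ∃[ S ] f S ≡ minSubset n f
minSubset-attained zero    f = [] , refl
minSubset-attained (suc n) f
  with ℕ.⊓-sel (minSubset n (f ∘ (inside ∷_))) (minSubset n (f ∘ (outside ∷_)))
... | inj₁ eq = let S , h = minSubset-attained n (f ∘ (inside ∷_))  in inside ∷ S , trans h (sym eq)
... | inj₂ eq = let S , h = minSubset-attained n (f ∘ (outside ∷_)) in outside ∷ S , trans h (sym eq)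

funToFin-cong : {f g : Fin m → Fin n} → (∀ i → f i ≡ g i) → funToFin f ≡ funToFin g
funToFin-cong {zero}  h = refl
funToFin-cong {suc m} h = cong₂ combine (h zero) (funToFin-cong (h ∘ suc))

-- Inverse to `index`: the binary coding by which subsets of a `k`-element set number the terms,
-- rows and columns below.
bits : ∀ k → Fin (2 ^ k) → Vec Bool k
bits k i = tabulate (Inverse.to Fin.2↔Bool ∘ finToFun i)

index : Vec Bool k → Fin (2 ^ k)
index cs = funToFin (Inverse.from Fin.2↔Bool ∘ lookup cs)

bits-index : (cs : Vec Bool k) → bits k (index cs) ≡ cs
bits-index cs = lookup-ext λ i → trans (Vec.lookup∘tabulate _ i)
  (trans (cong (Inverse.to Fin.2↔Bool) (Fin.finToFun-funToFin (Inverse.from Fin.2↔Bool ∘ lookup cs) i))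
         (Inverse.strictlyInverseˡ Fin.2↔Bool (lookup cs i)))

index-bits : ∀ k (i : Fin (2 ^ k)) → index (bits k i) ≡ i
index-bits k i = trans
  (funToFin-cong {k} λ j → trans
    (cong (Inverse.from Fin.2↔Bool) (Vec.lookup∘tabulate (Inverse.to Fin.2↔Bool ∘ finToFun i) j))
    (Inverse.strictlyInverseʳ Fin.2↔Bool (finToFun i j)))
  (Fin.funToFin-finToFin {k} {2} i)

module _ (G : FiniteGraph n m) where

  lookup-δ : ∀ S e → lookup (δ G S) e ≡ lookup S (end₁ G e) xor lookup S (end₂ G e)
  lookup-δ S e = Vec.lookup∘tabulate _ e

  δ-⊕ : ∀ S T → δ G (S ⊕ T) ≡ δ G S ⊕ δ G T
  δ-⊕ S T = lookup-ext λ e → begin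
    lookup (δ G (S ⊕ T)) e                                         ≡⟨ lookup-δ (S ⊕ T) e ⟩
    lookup (S ⊕ T) (end₁ G e) xor lookup (S ⊕ T) (end₂ G e)        ≡⟨ cong₂ _xor_ (lookup-⊕ S T _) (lookup-⊕ S T _) ⟩
    (s₁ e xor t₁ e) xor (s₂ e xor t₂ e)                            ≡⟨ xor-interchange (s₁ e) (t₁ e) (s₂ e) (t₂ e) ⟩
    (s₁ e xor s₂ e) xor (t₁ e xor t₂ e)                            ≡⟨ cong₂ _xor_ (lookup-δ S e) (lookup-δ T e) ⟨
    lookup (δ G S) e xor lookup (δ G T) e                          ≡⟨ lookup-⊕ (δ G S) (δ G T) e ⟨
    lookup (δ G S ⊕ δ G T) e                                       ∎
    where
    open ≡-Reasoning
    s₁ s₂ t₁ t₂ : Fin m → Bool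
    s₁ = lookup S ∘ end₁ G
    s₂ = lookup S ∘ end₂ G
    t₁ = lookup T ∘ end₁ G
    t₂ = lookup T ∘ end₂ G

  δ-∁ : ∀ S → δ G (∁ S) ≡ δ G S
  δ-∁ S = lookup-ext λ e → begin
    lookup (δ G (∁ S)) e                                    ≡⟨ lookup-δ (∁ S) e ⟩
    lookup (∁ S) (end₁ G e) xor lookup (∁ S) (end₂ G e)     ≡⟨ cong₂ _xor_ (Vec.lookup-map _ not S) (Vec.lookup-map _ not S) ⟩
    not (lookup S (end₁ G e)) xor not (lookup S (end₂ G e)) ≡⟨ not-xor-not (lookup S (end₁ G e)) (lookup S (end₂ G e)) ⟩
    lookup S (end₁ G e) xor lookup S (end₂ G e)             ≡⟨ lookup-δ S e ⟨
    lookup (δ G S) e                                        ∎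
    where
    open ≡-Reasoning
    not-xor-not : ∀ a b → not a xor not b ≡ a xor b
    not-xor-not true  b = refl
    not-xor-not false b = Bool.not-involutive b

  δ-scale : ∀ c S → δ G (map (c ∧_) S) ≡ map (c ∧_) (δ G S)
  δ-scale c S = lookup-ext λ e → begin
    lookup (δ G (map (c ∧_) S)) e                             ≡⟨ lookup-δ (map (c ∧_) S) e ⟩
    lookup (map (c ∧_) S) (end₁ G e) xor lookup (map (c ∧_) S) (end₂ G e)
      ≡⟨ cong₂ _xor_ (Vec.lookup-map _ (c ∧_) S) (Vec.lookup-map _ (c ∧_) S) ⟩
    (c ∧ lookup S (end₁ G e)) xor (c ∧ lookup S (end₂ G e))   ≡⟨ Bool.∧-distribˡ-xor c _ _ ⟨
    c ∧ (lookup S (end₁ G e) xor lookup S (end₂ G e))         ≡⟨ cong (c ∧_) (lookup-δ S e) ⟨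
    c ∧ lookup (δ G S) e                                      ≡⟨ Vec.lookup-map e (c ∧_) (δ G S) ⟨
    lookup (map (c ∧_) (δ G S)) e                             ∎
    where open ≡-Reasoning

  δ-⊥ : δ G ⊥ ≡ ⊥
  δ-⊥ = lookup-ext λ e → trans (lookup-δ ⊥ e)
    (trans (cong₂ _xor_ (lookup-⊥ (end₁ G e)) (lookup-⊥ (end₂ G e))) (sym (lookup-⊥ e)))

  combination-δ : ∀ cs (bs : Vec (Subset n) k) → combination cs (map (δ G) bs) ≡ δ G (combination cs bs)
  combination-δ []       []       = sym δ-⊥
  combination-δ (c ∷ cs) (b ∷ bs) = begin
    map (c ∧_) (δ G b) ⊕ combination cs (map (δ G) bs)  ≡⟨ cong₂ _⊕_ (sym (δ-scale c b)) (combination-δ cs bs) ⟩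
    δ G (map (c ∧_) b) ⊕ δ G (combination cs bs)        ≡⟨ δ-⊕ (map (c ∧_) b) (combination cs bs) ⟨
    δ G (map (c ∧_) b ⊕ combination cs bs)              ∎
    where open ≡-Reasoning

  -- All three dimensions in the state complexity come from this. The boundary map is linear, so a
  -- trivial kernel on the subsets of `F` makes the stars of the vertices of `F` independent, and
  -- the last two hypotheses say that they span exactly `C`.
  stars-dimension : (C : Pred (Subset m) _) (F : Subset n) →
    (∀ cs → δ G (scatter F cs) ≡ ⊥ → scatter F cs ≡ ⊥) →
    (∀ cs → C (δ G (scatter F cs))) →
    (∀ c → C c → ∃[ S ] δ G S ≡ c × (∀ v → lookup F v ≡ false → lookup S v ≡ false)) →
    HasDimension C ∣ F ∣
  stars-dimension C F kernel member spanning =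
      map (δ G) (singletons F)
    , (λ cs eq → begin
        cs                       ≡⟨ gather-scatter F cs ⟨
        gather F (scatter F cs)  ≡⟨ cong (gather F) (kernel cs (trans (sym (comb cs)) eq)) ⟩
        gather F ⊥               ≡⟨ gather-⊥ F ⟩
        replicate _ false        ∎)
    , λ c → mk⇔
        (λ Cc → let S , δS≡c , off = spanning c Cc in
          gather F S , trans (comb (gather F S))
            (trans (cong (δ G) (trans (scatter-gather F S) (supported-∩ S F off))) δS≡c))
        (λ (cs , eq) → subst C (trans (sym (comb cs)) eq) (member cs))
    where
    open ≡-Reasoning
    comb : ∀ cs → combination cs (map (δ G) (singletons F)) ≡ δ G (scatter F cs)
    comb cs = trans (combination-δ cs (singletons F)) (cong (δ G) (combination-singletons F cs))

  -- Normalizes the representation of a cut: of `S` and `∁ S`, which have the same boundary, the one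
  -- without `b` is chosen.
  avoiding : ∀ b S → ∃[ S′ ] δ G S′ ≡ δ G S × lookup S′ b ≡ false
  avoiding b S with lookup S b in eq
  ... | false = S , refl , eq
  ... | true  = ∁ S , δ-∁ S , trans (Vec.lookup-map b not S) (cong not eq)

walk-constant : {V E : Set} (H : Graph V E) (f : V → X) → (∀ e → f (end₁ H e) ≡ f (end₂ H e)) →
                ∀ {u v} → Star (Adjacent H) u v → f u ≡ f v
walk-constant H f h = fold (λ u v → f u ≡ f v) step refl
  where
  step : ∀ {u v w} → Adjacent H u v → f v ≡ f w → f u ≡ f w
  step (e , inj₁ (refl , refl)) eq = trans (h e) eq
  step (e , inj₂ (refl , refl)) eq = trans (sym (h e)) eq

-- The bipartition (E(A) ∪ E(A,B), E(B))

∈⇒true : ∀ {p : Subset n} {i} → i ∈ p → lookup p i ≡ true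
∈⇒true = Vec.[]=⇒lookup

true⇒∈ : ∀ {p : Subset n} {i} → lookup p i ≡ true → i ∈ p
true⇒∈ = Vec.lookup⇒[]= _ _

partition-lookup : {A B : Subset n} → A ∪ B ≡ ⊤ → A ∩ B ≡ ⊥ → ∀ v → lookup B v ≡ not (lookup A v)
partition-lookup {A = A} {B} A∪B≡⊤ A∩B≡⊥ v = complementary (lookup A v) (lookup B v)
  (trans (sym (lookup-∪ A B v)) (trans (cong (λ p → lookup p v) A∪B≡⊤) (Vec.lookup-replicate v true)))
  (trans (sym (lookup-∩ A B v)) (trans (cong (λ p → lookup p v) A∩B≡⊥) (lookup-⊥ v)))
  where
  complementary : ∀ a b → a ∨ b ≡ true → a ∧ b ≡ false → b ≡ not a
  complementary true  b     _ eq = eq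
  complementary false b     eq _ = eq

-- The support proof is irrelevant, so it cannot produce the equation itself; it only refutes the
-- case in which the bit is set.
lookup-vector-off : {F : Subset m} (ω : 𝔽₂^ F) → ∀ e → lookup F e ≡ false → lookup (vector ω) e ≡ false
lookup-vector-off {F = F} (supported p p⊆F) e e∉F with lookup p e in eq
... | false = refl
... | true  = ⊥-elim-irr (absurd (trans (sym e∉F) (∈⇒true (p⊆F (true⇒∈ eq)))))
  where
  absurd : false ≡ true → Empty.⊥
  absurd ()

∈-E⟨⟩ : (G : FiniteGraph n m) (X : Subset n) → ∀ {e} → end₁ G e ∈ X → end₂ G e ∈ X → e ∈ E⟨ G ⟩ X
∈-E⟨⟩ G X {e} p q = true⇒∈ (trans (Vec.lookup∘tabulate _ e) (cong₂ _∧_ (∈⇒true p) (∈⇒true q)))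

xor≡false⇒≡ : ∀ a b → a xor b ≡ false → a ≡ b
xor≡false⇒≡ true  true  eq = refl
xor≡false⇒≡ false b     eq = sym eq

-- When no edge inside `X` is cut, `S` meets `X` in a union of components of the induced graph, and
-- there is only one component.
constant-on : (G : FiniteGraph n m) (X S : Subset n) → Connected (Induced G X) →
              (∀ {e} → e ∈ E⟨ G ⟩ X → lookup (δ G S) e ≡ false) →
              ∀ {u v} → u ∈ X → v ∈ X → lookup S u ≡ lookup S v
constant-on G X S (_ , walk) h u∈X v∈X =
  walk-constant (Induced G X) (lookup S ∘ proj₁)
    (λ (e , p , q) → xor≡false⇒≡ _ _ (trans (sym (lookup-δ G S e)) (h (∈-E⟨⟩ G X p q))))
    (walk (_ , u∈X) (_ , v∈X))

module Bipartition {n m : ℕ} (G : FiniteGraph n m) (A B : Subset n)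
  (A∪B≡⊤ : A ∪ B ≡ ⊤) (A∩B≡⊥ : A ∩ B ≡ ⊥)
  (A-connected : Connected (Induced G A)) (B-connected : Connected (Induced G B))
  (B-dominated : ∀ b → b ∈ B → ∃[ a ] (a ∈ A × Adjacent G b a)) where

  L R : Subset m
  L = E⟨ G ⟩ A ∪ E⟨ G ⟩₂ A B
  R = E⟨ G ⟩ B

  W : 𝔽₂^ L → 𝔽₂^ R → ℕ
  W = groundState G L R

  root : Fin n
  root = proj₁ (proj₁ B-connected)

  root∈B : root ∈ B
  root∈B = proj₂ (proj₁ B-connected)

  -- The side of a cut that avoids `root` meets `B` in a subset of `F`, so these subsets parametrize
  -- what a cut can do on `B`.
  F : Subset n
  F = B - root

  s : ℕ
  s = ∣ F ∣

  B≡not-A : ∀ v → lookup B v ≡ not (lookup A v)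
  B≡not-A = partition-lookup A∪B≡⊤ A∩B≡⊥

  A≡not-B : ∀ v → lookup A v ≡ not (lookup B v)
  A≡not-B v = trans (sym (Bool.not-involutive _)) (cong not (sym (B≡not-A v)))

  L≡not-R : ∀ e → lookup L e ≡ not (lookup R e)
  L≡not-R e = begin
    lookup L e
      ≡⟨ trans (lookup-∪ (E⟨ G ⟩ A) _ e) (cong₂ _∨_ (Vec.lookup∘tabulate _ e) (Vec.lookup∘tabulate _ e)) ⟩
    (a₁ ∧ a₂) ∨ ((a₁ ∧ lookup B (end₂ G e)) ∨ (lookup B (end₁ G e) ∧ a₂))
      ≡⟨ cong₂ (λ b₁ b₂ → (a₁ ∧ a₂) ∨ ((a₁ ∧ b₂) ∨ (b₁ ∧ a₂))) (B≡not-A (end₁ G e)) (B≡not-A (end₂ G e)) ⟩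
    (a₁ ∧ a₂) ∨ ((a₁ ∧ not a₂) ∨ (not a₁ ∧ a₂))
      ≡⟨ table a₁ a₂ ⟩
    not (not a₁ ∧ not a₂)
      ≡⟨ cong₂ (λ b₁ b₂ → not (b₁ ∧ b₂)) (B≡not-A (end₁ G e)) (B≡not-A (end₂ G e)) ⟨
    not (lookup B (end₁ G e) ∧ lookup B (end₂ G e))
      ≡⟨ cong not (Vec.lookup∘tabulate _ e) ⟨
    not (lookup R e) ∎
    where
    open ≡-Reasoning
    a₁ a₂ : Bool
    a₁ = lookup A (end₁ G e)
    a₂ = lookup A (end₂ G e)
    table : ∀ a b → (a ∧ b) ∨ ((a ∧ not b) ∨ (not a ∧ b)) ≡ not (not a ∧ not b)
    table true  true  = refl
    table true  false = refl
    table false true  = refl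
    table false false = refl

  R⇒ends : ∀ {e} → e ∈ R → end₁ G e ∈ B × end₂ G e ∈ B
  R⇒ends {e} e∈R = let b₁ , b₂ = both _ _ (trans (sym (Vec.lookup∘tabulate _ e)) (∈⇒true e∈R)) in
    true⇒∈ b₁ , true⇒∈ b₂
    where
    both : ∀ x y → x ∧ y ≡ true → x ≡ true × y ≡ true
    both true y eq = refl , eq

  ∈-crossing : ∀ {e a b} → a ∈ A → b ∈ B →
               (end₁ G e ≡ a × end₂ G e ≡ b) ⊎ (end₁ G e ≡ b × end₂ G e ≡ a) → e ∈ L
  ∈-crossing {e} a∈A b∈B ends = Subset.x∈p∪q⁺ {p = E⟨ G ⟩ A} (inj₂ (true⇒∈
    (trans (Vec.lookup∘tabulate _ e) (crossing ends))))
    where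
    crossing : (end₁ G e ≡ _ × end₂ G e ≡ _) ⊎ (end₁ G e ≡ _ × end₂ G e ≡ _) →
      (lookup A (end₁ G e) ∧ lookup B (end₂ G e)) ∨ (lookup B (end₁ G e) ∧ lookup A (end₂ G e)) ≡ true
    crossing (inj₁ (refl , refl)) rewrite ∈⇒true a∈A | ∈⇒true b∈B = refl
    crossing (inj₂ (refl , refl)) rewrite ∈⇒true a∈A | ∈⇒true b∈B = Bool.∨-zeroʳ _

  constant-on-B : ∀ S → (∀ {e} → e ∈ R → lookup (δ G S) e ≡ false) →
                  ∀ {u v} → u ∈ B → v ∈ B → lookup S u ≡ lookup S v
  constant-on-B S = constant-on G B S B-connected

  -- Connectedness of `G[A]` makes `S` constant on `A`. Each vertex of `B` has a neighbour in `A`,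
  -- and the edge between them lies in `L`, so the vertex takes the same value.
  constant-everywhere : ∀ S → (∀ {e} → e ∈ L → lookup (δ G S) e ≡ false) →
                        ∀ u v → lookup S u ≡ lookup S v
  constant-everywhere S h u v = trans (to-base u) (sym (to-base v))
    where
    a₀ : Fin n
    a₀ = proj₁ (proj₁ A-connected)
    on-A : ∀ {u} → u ∈ A → lookup S u ≡ lookup S a₀
    on-A u∈A = constant-on G A S A-connected (h ∘ Subset.p⊆p∪q _) u∈A (proj₂ (proj₁ A-connected))
    edge : ∀ {e a b} → a ∈ A → b ∈ B →
           (end₁ G e ≡ a × end₂ G e ≡ b) ⊎ (end₁ G e ≡ b × end₂ G e ≡ a) → lookup S b ≡ lookup S a
    edge {e} a∈A b∈B ends with ends | xor≡false⇒≡ (lookup S (end₁ G e)) (lookup S (end₂ G e))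
      (trans (sym (lookup-δ G S e)) (h (∈-crossing a∈A b∈B ends)))
    ... | inj₁ (refl , refl) | eq = sym eq
    ... | inj₂ (refl , refl) | eq = eq
    to-base : ∀ u → lookup S u ≡ lookup S a₀
    to-base u with lookup A u in eq
    ... | true  = on-A (true⇒∈ eq)
    ... | false with B-dominated u (true⇒∈ (trans (B≡not-A u) (cong not eq)))
    ...   | a , a∈A , e , ends = trans
      (edge a∈A (true⇒∈ (trans (B≡not-A u) (cong not eq))) ([ inj₂ , inj₁ ]′ ends)) (on-A a∈A)

  cut-kernel : ∀ S v → lookup S v ≡ false → δ G S ≡ ⊥ → S ≡ ⊥
  cut-kernel S v Sv≡false δS≡⊥ = lookup-ext λ u → trans
    (constant-everywhere S (λ {e} _ → trans (cong (λ p → lookup p e) δS≡⊥) (lookup-⊥ e)) u v)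
    (trans Sv≡false (sym (lookup-⊥ u)))

  root∉A : lookup A root ≡ false
  root∉A = trans (A≡not-B root) (cong not (∈⇒true root∈B))

  -- Dimensions and the state complexity

  cutSpace-dimension : HasDimension (CutSpace G) ∣ ⊤ - root ∣
  cutSpace-dimension = stars-dimension G (CutSpace G) (⊤ - root)
    (λ cs → cut-kernel _ root (scatter-supported (⊤ - root) cs root (lookup-minus-self ⊤ root)))
    (λ cs → scatter (⊤ - root) cs , refl)
    (λ c (S , δS≡c) → let S′ , δS′≡δS , S′root = avoiding G root S in
      S′ , trans δS′≡δS δS≡c , λ v v∉ → [ (λ v≡root → trans (cong (lookup S′) v≡root) S′root)
                                         , (λ v∉⊤ → contradiction (trans (sym v∉⊤) (Vec.lookup-replicate v true)) λ ())
                                         ]′ (lookup-minus ⊤ root v v∉))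

  -- A cut without edges in `G[B]` has `B` on one side, so its side avoiding `root` is a subset of
  -- `A`. Conversely, subsets of `A` cut no edge with both ends in `B`.
  left-dimension : HasDimension (VanishingOn (CutSpace G) R) ∣ A ∣
  left-dimension = stars-dimension G (VanishingOn (CutSpace G) R) A
    (λ cs → cut-kernel _ root (scatter-supported A cs root root∉A))
    (λ cs → (scatter A cs , refl) , λ e e∈R → let e₁∈B , e₂∈B = R⇒ends e∈R in
      trans (lookup-δ G (scatter A cs) e) (cong₂ _xor_ (zero-on-B cs e₁∈B) (zero-on-B cs e₂∈B)))
    (λ { c ((S , refl) , vanishes) → let S′ , δS′≡δS , S′root = avoiding G root S in
      S′ , δS′≡δS , λ v v∉A → trans
        (constant-on-B S′ (λ {e} e∈R → trans (cong (λ p → lookup p e) δS′≡δS) (vanishes e e∈R))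
          (true⇒∈ (trans (B≡not-A v) (cong not v∉A))) root∈B) S′root })
    where
    zero-on-B : ∀ cs {v} → v ∈ B → lookup (scatter A cs) v ≡ false
    zero-on-B cs {v} v∈B = scatter-supported A cs v (trans (A≡not-B v) (cong not (∈⇒true v∈B)))

  -- A cut without edges in `L` has a constant side and is zero. The dimension 0 appears as `∣ ⊥ ∣`
  -- so that the empty set of stars serves as basis.
  right-dimension : HasDimension (VanishingOn (CutSpace G) L) ∣ ⊥ {n} ∣
  right-dimension = stars-dimension G (VanishingOn (CutSpace G) L) ⊥
    (λ cs → cut-kernel _ root (vanishing cs root))
    (λ cs → (scatter ⊥ cs , refl) , λ e _ → trans (lookup-δ G (scatter ⊥ cs) e) (cong₂ _xor_ (vanishing cs _) (vanishing cs _)))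
    (λ { c ((S , refl) , vanishes) → let S′ , δS′≡δS , S′root = avoiding G root S in
      S′ , δS′≡δS , λ v _ → trans
        (constant-everywhere S′ (λ {e} e∈L → trans (cong (λ p → lookup p e) δS′≡δS) (vanishes e e∈L)) v root)
        S′root })
    where
    vanishing : ∀ cs v → lookup (scatter (⊥ {n}) cs) v ≡ false
    vanishing cs v = scatter-supported ⊥ cs v (lookup-⊥ v)

  -- Putting `root` back on both sides leaves the count of the partition of the vertices into `B`
  -- and `A`.
  ∣F∣+∣A∣≡∣⊤-root∣ : ∣ F ∣ + ∣ A ∣ ≡ ∣ ⊤ - root ∣
  ∣F∣+∣A∣≡∣⊤-root∣ = ℕ.suc-injective (begin
    suc ∣ F ∣ + ∣ A ∣        ≡⟨ cong (_+ ∣ A ∣) (suc∣p-x∣≡∣p∣ B root (∈⇒true root∈B)) ⟩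
    ∣ B ∣ + ∣ A ∣            ≡⟨ cong₂ (λ p q → ∣ p ∣ + ∣ q ∣) (Subset.∩-identityˡ B) (Subset.∩-identityˡ A) ⟨
    ∣ ⊤ ∩ B ∣ + ∣ ⊤ ∩ A ∣    ≡⟨ ∣p∣≡∣p∩L∣+∣p∩R∣ B A ⊤ B≡not-A ⟨
    ∣ ⊤ {n} ∣                ≡⟨ suc∣p-x∣≡∣p∣ ⊤ root (Vec.lookup-replicate root true) ⟨
    suc ∣ ⊤ - root ∣         ∎)
    where open ≡-Reasoning

  stateComplexity : StateComplexity (CutSpace G) L R ∣ F ∣
  stateComplexity = _ , _ , _ , cutSpace-dimension , left-dimension , right-dimension ,
    trans (cong (∣ F ∣ + ∣ A ∣ +_) (Subset.∣⊥∣≡0 n)) (trans (ℕ.+-identityʳ _) ∣F∣+∣A∣≡∣⊤-root∣)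

  -- The factorization with one term for each subset of `F`

  T : Fin (2 ^ s) → Subset n
  T t = scatter F (bits s t)

  T-injective : ∀ {i j} → T i ≡ T j → i ≡ j
  T-injective {i} {j} Ti≡Tj = trans (sym (index-bits s i)) (trans (cong index (begin
    bits s i    ≡⟨ gather-scatter F (bits s i) ⟨
    gather F (T i)  ≡⟨ cong (gather F) Ti≡Tj ⟩
    gather F (T j)  ≡⟨ gather-scatter F (bits s j) ⟩
    bits s j    ∎)) (index-bits s j))
    where open ≡-Reasoning

  T-surjective : ∀ S → ∃[ t ] T t ≡ S ∩ F
  T-surjective S = index (gather F S) ,
    trans (cong (scatter F) (bits-index (gather F S))) (scatter-gather F S)

  T-root : ∀ t → lookup (T t) root ≡ false
  T-root t = scatter-supported F _ root (lookup-minus-self B root)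

  T-off-B : ∀ t v → lookup B v ≡ false → lookup (T t) v ≡ false
  T-off-B t v v∉B = scatter-supported F _ v (lookup-minus-⊆ B root v v∉B)

  -- The number of negative edges within `E` after switching the signing `ω` at `S`.
  energy : (ω : Subset m) → Subset n → Subset m → ℕ
  energy ω S E = ∣ (ω ⊕ δ G S) ∩ E ∣

  energy-cong : ∀ ω ω′ S S′ E → (∀ e → lookup E e ≡ true →
                  lookup ω e ≡ lookup ω′ e × lookup (δ G S) e ≡ lookup (δ G S′) e) →
                energy ω S E ≡ energy ω′ S′ E
  energy-cong ω ω′ S S′ E h = ∣∣-cong ((ω ⊕ δ G S) ∩ E) ((ω′ ⊕ δ G S′) ∩ E) (λ e → begin
    lookup ((ω ⊕ δ G S) ∩ E) e                            ≡⟨ expand ω S e ⟩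
    (lookup ω e xor lookup (δ G S) e) ∧ lookup E e        ≡⟨ restrict (lookup E e) (λ eq → cong₂ _xor_ (proj₁ (h e eq)) (proj₂ (h e eq))) ⟩
    (lookup ω′ e xor lookup (δ G S′) e) ∧ lookup E e      ≡⟨ expand ω′ S′ e ⟨
    lookup ((ω′ ⊕ δ G S′) ∩ E) e                          ∎)
    where
    open ≡-Reasoning
    expand : ∀ ω S e → lookup ((ω ⊕ δ G S) ∩ E) e ≡ (lookup ω e xor lookup (δ G S) e) ∧ lookup E e
    expand ω S e = trans (lookup-∩ (ω ⊕ δ G S) E e) (cong (_∧ lookup E e) (lookup-⊕ ω (δ G S) e))
    restrict : ∀ {x y} b → (b ≡ true → x ≡ y) → x ∧ b ≡ y ∧ b
    restrict {x} {y} true  h = cong (_∧ true) (h refl)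
    restrict {x} {y} false h = trans (Bool.∧-zeroʳ x) (sym (Bool.∧-zeroʳ y))

  -- `L` and `R` are complementary, and on each of them the half of the signing supported on the
  -- other vanishes.
  energy-split : ∀ (ωL : 𝔽₂^ L) (ωR : 𝔽₂^ R) S →
    ∣ (vector ωL ⊕ vector ωR) ⊕ δ G S ∣ ≡ energy (vector ωL) S L + energy (vector ωR) S R
  energy-split ωL ωR S = trans
    (∣p∣≡∣p∩L∣+∣p∩R∣ L R ((vector ωL ⊕ vector ωR) ⊕ δ G S) L≡not-R)
    (cong₂ _+_
      (energy-cong (vector ωL ⊕ vector ωR) (vector ωL) S S L λ e e∈L → trans (lookup-⊕ (vector ωL) (vector ωR) e)
        (trans (cong (lookup (vector ωL) e xor_) (lookup-vector-off ωR e
          (Bool.not-injective (trans (sym (L≡not-R e)) e∈L)))) (Bool.xor-identityʳ _)) , refl)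
      (energy-cong (vector ωL ⊕ vector ωR) (vector ωR) S S R λ e e∈R → trans (lookup-⊕ (vector ωL) (vector ωR) e)
        (cong (_xor lookup (vector ωR) e) (lookup-vector-off ωL e
          (trans (L≡not-R e) (cong not e∈R)))) , refl))

  W≤ : ∀ ωL ωR S → W ωL ωR ≤ energy (vector ωL) S L + energy (vector ωR) S R
  W≤ ωL ωR S = ℕ.≤-trans (minSubset≤ n _ S) (ℕ.≤-reflexive (energy-split ωL ωR S))

  glue : Subset n → Fin (2 ^ s) → Subset n
  glue S t = (S ∩ A) ∪ T t

  -- `S` ranges over all vertex sets, but `glue` retains only its part in `A`: this is the minimum
  -- over that part with the part in `B` fixed.
  rowTerm : Fin (2 ^ s) → 𝔽₂^ L → ℕ
  rowTerm t ωL = minSubset n λ S → energy (vector ωL) (glue S t) L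

  columnTerm : Fin (2 ^ s) → 𝔽₂^ R → ℕ
  columnTerm t ωR = energy (vector ωR) (T t) R

  glue-on-B : ∀ S t {v} → v ∈ B → lookup (glue S t) v ≡ lookup (T t) v
  glue-on-B S t {v} v∈B = trans (lookup-∪ (S ∩ A) (T t) v) (cong (_∨ lookup (T t) v)
    (trans (lookup-∩ S A v) (trans (cong (lookup S v ∧_) (trans (A≡not-B v) (cong not (∈⇒true v∈B))))
      (Bool.∧-zeroʳ _))))

  -- Edges of `R` have both ends in `B`, where the glued set is `T t`. Hence the column term does
  -- not depend on the choice made in `A`.
  energy-glue : ∀ ω S t → energy ω (glue S t) R ≡ energy ω (T t) R
  energy-glue ω S t = energy-cong ω ω (glue S t) (T t) R λ e e∈R →
    let e₁∈B , e₂∈B = R⇒ends (true⇒∈ e∈R) in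
    refl , trans (lookup-δ G (glue S t) e)
      (trans (cong₂ _xor_ (glue-on-B S t e₁∈B) (glue-on-B S t e₂∈B)) (sym (lookup-δ G (T t) e)))

  -- `A` and `F` together miss only `root`, so a set avoiding `root` is recovered from its traces on
  -- them.
  glue-surjective : ∀ S → lookup S root ≡ false → ∃[ t ] glue S t ≡ S
  glue-surjective S Sroot with T-surjective S
  ... | t , Tt≡S∩F = t , (begin
    (S ∩ A) ∪ T t      ≡⟨ cong ((S ∩ A) ∪_) Tt≡S∩F ⟩
    (S ∩ A) ∪ (S ∩ F)  ≡⟨ Subset.∩-distribˡ-∪ S A F ⟨
    S ∩ (A ∪ F)        ≡⟨ supported-∩ S (A ∪ F) off ⟩
    S                  ∎)
    where
    open ≡-Reasoning
    neither : ∀ x y → x ∨ y ≡ false → x ≡ false × y ≡ false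
    neither false y eq = refl , eq
    off : ∀ v → lookup (A ∪ F) v ≡ false → lookup S v ≡ false
    off v v∉ with neither _ _ (trans (sym (lookup-∪ A F v)) v∉)
    ... | v∉A , v∉F with lookup-minus B root v v∉F
    ...   | inj₁ refl = Sroot
    ...   | inj₂ v∉B  = contradiction (trans (sym v∉B) (trans (B≡not-A v) (cong not v∉A))) λ ()

  -- For the bound, an optimal `S` of the row term gives the cut of `glue S t` as a candidate for
  -- `W`. For attainment, an optimal cut is represented by its side avoiding `root`, whose trace on
  -- `F` selects the term.
  factorization : IsNatFactorization W rowTerm columnTerm
  factorization = record { bound = bound ; attained = attained }
    where
    bound : ∀ ωL ωR t → W ωL ωR ≤ rowTerm t ωL + columnTerm t ωR
    bound ωL ωR t with minSubset-attained n (λ S → energy (vector ωL) (glue S t) L)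
    ... | S , eq = begin
      W ωL ωR                                                            ≤⟨ W≤ ωL ωR (glue S t) ⟩
      energy (vector ωL) (glue S t) L + energy (vector ωR) (glue S t) R  ≡⟨ cong₂ _+_ eq (energy-glue (vector ωR) S t) ⟩
      rowTerm t ωL + columnTerm t ωR                                     ∎
      where open ℕ.≤-Reasoning
    attained : ∀ ωL ωR → ∃[ t ] rowTerm t ωL + columnTerm t ωR ≤ W ωL ωR
    attained ωL ωR with minSubset-attained n (λ S → ∣ (vector ωL ⊕ vector ωR) ⊕ δ G S ∣)
    ... | S₀ , eq with avoiding G root S₀
    ...   | S , δS≡δS₀ , Sroot with glue-surjective S Sroot
    ...     | t , glue≡S = t , (begin
      rowTerm t ωL + columnTerm t ωR
        ≤⟨ ℕ.+-mono-≤ (minSubset≤ n _ S) (ℕ.≤-reflexive (sym (energy-glue (vector ωR) S t))) ⟩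
      energy (vector ωL) (glue S t) L + energy (vector ωR) (glue S t) R
        ≡⟨ energy-split ωL ωR (glue S t) ⟨
      ∣ (vector ωL ⊕ vector ωR) ⊕ δ G (glue S t) ∣
        ≡⟨ cong (λ c → ∣ (vector ωL ⊕ vector ωR) ⊕ c ∣) (trans (cong (δ G) glue≡S) δS≡δS₀) ⟩
      ∣ (vector ωL ⊕ vector ωR) ⊕ δ G S₀ ∣
        ≡⟨ eq ⟩
      W ωL ωR ∎)
      where open ℕ.≤-Reasoning

  -- The square submatrix with zeros exactly on its diagonal

  row : Fin (2 ^ s) → 𝔽₂^ L
  row t = supported (δ G (T t) ∩ L) (Subset.p∩q⊆q _ _)

  column : Fin (2 ^ s) → 𝔽₂^ R
  column t = supported (δ G (T t) ∩ R) (Subset.p∩q⊆q _ _)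

  -- Membership in `L` is written as the negation of membership in `R`, so that the claims about a
  -- single edge become truth tables.
  lookup-residual : ∀ i j S e →
    lookup ((vector (row i) ⊕ vector (column j)) ⊕ δ G S) e ≡
    ((lookup (δ G (T i)) e ∧ not (lookup R e)) xor (lookup (δ G (T j)) e ∧ lookup R e)) xor lookup (δ G S) e
  lookup-residual i j S e = trans (lookup-⊕ (vector (row i) ⊕ vector (column j)) (δ G S) e)
    (cong (_xor lookup (δ G S) e) (trans (lookup-⊕ (vector (row i)) (vector (column j)) e)
      (cong₂ _xor_ (trans (lookup-∩ (δ G (T i)) L e) (cong (lookup (δ G (T i)) e ∧_) (L≡not-R e)))
                   (lookup-∩ (δ G (T j)) R e))))

  zeroExactlyOnDiagonal : ZeroExactlyOnDiagonal W row column
  zeroExactlyOnDiagonal = record { zero-diagonal = zero-diagonal ; diagonal-only = diagonal-only }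
    where
    merge : ∀ d r → ((d ∧ not r) xor (d ∧ r)) xor d ≡ false
    merge true  true  = refl
    merge true  false = refl
    merge false r     = refl
    zero-diagonal : ∀ i → W (row i) (column i) ≡ 0
    -- The minimum is tested at `T i`: row and column together form the whole cut of `T i`, which
    -- cancels it.
    zero-diagonal i = ℕ.n≤0⇒n≡0 (ℕ.≤-trans (minSubset≤ n _ (T i)) (ℕ.≤-reflexive (trans
      (∣∣-cong ((vector (row i) ⊕ vector (column i)) ⊕ δ G (T i)) ⊥ (λ e → trans (lookup-residual i i (T i) e)
        (trans (merge (lookup (δ G (T i)) e) (lookup R e)) (sym (lookup-⊥ e)))))
      (Subset.∣⊥∣≡0 m))))
    left : ∀ d d′ c {r} → not r ≡ true → ((d ∧ not r) xor (d′ ∧ r)) xor c ≡ false → d xor c ≡ false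
    left true  true  c {false} _ eq = eq
    left true  false c {false} _ eq = eq
    left false true  c {false} _ eq = eq
    left false false c {false} _ eq = eq
    right : ∀ d d′ c {r} → r ≡ true → ((d ∧ not r) xor (d′ ∧ r)) xor c ≡ false → d′ xor c ≡ false
    right true  true  c refl eq = eq
    right true  false c refl eq = eq
    right false true  c refl eq = eq
    right false false c refl eq = eq
    diagonal-only : ∀ i j → W (row i) (column j) ≡ 0 → i ≡ j
    diagonal-only i j W≡0 with minSubset-attained n (λ S → ∣ (vector (row i) ⊕ vector (column j)) ⊕ δ G S ∣)
    ... | S , eq = T-injective (lookup-ext Ti≡Tj)
      where
      residual : ∀ e → ((lookup (δ G (T i)) e ∧ not (lookup R e)) xor (lookup (δ G (T j)) e ∧ lookup R e)) xor lookup (δ G S) e ≡ false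
      residual e = trans (sym (lookup-residual i j S e))
        (trans (cong (λ p → lookup p e) (∣p∣≡0⇒p≡⊥ ((vector (row i) ⊕ vector (column j)) ⊕ δ G S) (trans eq W≡0))) (lookup-⊥ e))
      δ-sum : ∀ t e → lookup (δ G (T t ⊕ S)) e ≡ lookup (δ G (T t)) e xor lookup (δ G S) e
      δ-sum t e = trans (cong (λ p → lookup p e) (δ-⊕ G (T t) S)) (lookup-⊕ (δ G (T t)) (δ G S) e)
      root-sum : ∀ t → lookup (T t ⊕ S) root ≡ lookup S root
      root-sum t = trans (lookup-⊕ (T t) S root) (cong (_xor lookup S root) (T-root t))
      -- On `L` the cuts of `T i` and `S` agree, so their sum has no boundary there and is constant
      -- on all vertices; the constant is read off at `root`, which `T i` avoids.
      i-constant : ∀ v → lookup (T i ⊕ S) v ≡ lookup S root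
      i-constant v = trans (constant-everywhere (T i ⊕ S) (λ {e} e∈L → trans (δ-sum i e)
        (left (lookup (δ G (T i)) e) (lookup (δ G (T j)) e) (lookup (δ G S) e)
          (trans (sym (L≡not-R e)) (∈⇒true e∈L)) (residual e))) v root) (root-sum i)
      -- On `R` the cuts of `T j` and `S` agree, which yields constancy on `B` only, with the same
      -- constant.
      j-constant : ∀ {v} → v ∈ B → lookup (T j ⊕ S) v ≡ lookup S root
      j-constant v∈B = trans (constant-on-B (T j ⊕ S) (λ {e} e∈R → trans (δ-sum j e)
        (right (lookup (δ G (T i)) e) (lookup (δ G (T j)) e) (lookup (δ G S) e)
          (∈⇒true e∈R) (residual e))) v∈B root∈B) (root-sum j)
      Ti≡Tj : ∀ v → lookup (T i) v ≡ lookup (T j) v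
      Ti≡Tj v with lookup B v in v∈B
      ... | false = trans (T-off-B i v v∈B) (sym (T-off-B j v v∈B))
      -- On `B` both sums equal the value of `S` at `root`, and cancelling `S` identifies `T i` with
      -- `T j`.
      ... | true  = xor-cancelʳ _ _ (lookup S v) (trans (sym (lookup-⊕ (T i) S v))
        (trans (trans (i-constant v) (sym (j-constant (true⇒∈ v∈B)))) (lookup-⊕ (T j) S v)))

  -- The truncated subtraction is exact because `B` contains `root`.
  ∣F∣≡∣B∣∸1 : ∣ F ∣ ≡ ∣ B ∣ ∸ 1
  ∣F∣≡∣B∣∸1 = cong (_∸ 1) (suc∣p-x∣≡∣p∣ B root (∈⇒true root∈B))

corollary1 :
    ∀ (n m : ℕ) (G : FiniteGraph n m) (A B : Subset n) →
    Connected G →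
    A ∪ B ≡ ⊤ → A ∩ B ≡ ⊥ →
    Connected (Induced G A) →
    Connected (Induced G B) →
    (∀ b → b ∈ B → ∃[ a ] (a ∈ A × Adjacent G b a)) →
    let EL = E⟨ G ⟩ A ∪ E⟨ G ⟩₂ A B
        ER = E⟨ G ⟩ B
        W  = groundState G EL ER
    in StateComplexity (CutSpace G) EL ER (∣ B ∣ ∸ 1)
       × HasMinPlusRank W (2 ^ (∣ B ∣ ∸ 1))
       × HasTropicalRank W (2 ^ (∣ B ∣ ∸ 1))
corollary1 n m G A B _ A∪B≡⊤ A∩B≡⊥ A-connected B-connected B-dominated =
  subst (λ s → StateComplexity (CutSpace G) L R s × HasMinPlusRank W (2 ^ s) × HasTropicalRank W (2 ^ s))
    ∣F∣≡∣B∣∸1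
    ( stateComplexity
    , (factorization⇒minPlus factorization , zeroDiagonal⇒≤ zeroExactlyOnDiagonal)
    , (zeroDiagonal⇒uniquelyMinimized zeroExactlyOnDiagonal , λ r → uniquelyMinimized⇒≤ factorization) )
  where open Bipartition G A B A∪B≡⊤ A∩B≡⊥ A-connected B-connected B-dominated
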